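{- Let $n\ge 1$. For $1\le i,j\le n$, let $q_n^{\mathrm{i}}(i,j)$ denote the number of weakly-increasing parking functions of $1,\ldots,n$ in which the $i$-th car prefers the $j$-th spot and the $i$-th car is lucky. Then \[ q_n^{\mathrm{i}}(i,j)=\begin{cases} C_{i-1}C_{n-i+1}&\text{if }i=j,\\ 0&\text{otherwise.}\end{cases} \] In particular, for each $1\le i\le n$, the number of weakly-increasing parking functions of $1,\ldots,n$ for which the $i$-th car is lucky is $C_{i-1}C_{n-i+1}$, and likewise the number for which the $i$-th spot is lucky is $C_{i-1}C_{n-i+1}$.
   Context: There are $n$ spots labeled $1,\ldots,n$ in order along a one-way street, and $n$ cars entering one after another, car $i$ having preference $a_i\in\{1,\ldots,n\}$. Each car drives to its preferred spot and parks there if it is available; otherwise it moves forward and parks in the first available later spot, if any (if none, it fails to park). A parking function of $1,\ldots,n$ is a sequence of preferences $(a_1,\ldots,a_n)$ such that all $n$ cars are able to park; it is weakly-increasing if $a_1\le a_2\le\cdots\le a_n$. A car is lucky if it parks in its preferred spot; a spot is lucky if the car that parks in it prefers that spot. $C_m=\frac1{m+1}\binom{2m}{m}$ is the $m$-th Catalan number. -}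

module Defs where

open import Data.Fin.Base using (Fin; zero; suc) renaming (_≤_ to _≤ᶠ_)
open import Data.Fin.Properties using (_≟_; _≤?_; any?)
open import Data.Fin.Subset using (Subset; inside; outside; ⊥)
open import Data.List.Base as List using (List; allFin; cartesianProductWith; filter; length)
open import Data.List.Membership.Propositional using (_∈_)
open import Data.List.Membership.Propositional.Properties
  using (∈-allFin; ∈-cartesianProductWith⁺)
open import Data.List.Relation.Unary.Any using (here)
import Data.List.Relation.Unary.All as ListAll
open import Data.List.Relation.Unary.AllPairs using ([]; _∷_)
open import Data.List.Relation.Unary.Unique.Propositional using (Unique)
open import Data.List.Relation.Unary.Unique.Propositional.Properties
  using (allFin⁺; cartesianProductWith⁺)
open import Data.Maybe.Base using (Maybe; just; nothing) renaming (map to mapᴹ)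
open import Data.Maybe.Properties using (≡-dec)
open import Data.Maybe using (Is-just)
import Data.Maybe.Relation.Unary.Any as MaybeAny
open import Data.Nat.Base using (ℕ; zero; suc; _*_; _/_)
open import Data.Nat.Combinatorics using (_C_)
open import Data.Product.Base using (_×_; ∃-syntax)
open import Data.Unit.Base using (tt)
open import Data.Vec.Base using (Vec; []; _∷_; lookup; _[_]≔_)
open import Data.Vec.Properties using (∷-injective)
open import Data.Vec.Relation.Unary.All using (All; all?)
open import Data.Vec.Relation.Unary.Linked using (Linked; linked?)
open import Level using (0ℓ)
open import Relation.Binary.PropositionalEquality.Core using (_≡_; refl)
open import Relation.Nullary.Decidable using (yes; _×-dec_)
open import Relation.Unary using (Pred; Decidable)

-- Spots and cars are numbered from 0: the k-th spot (or car) is the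
-- element of Fin n whose toℕ is k − 1.

-- The division is exact.
catalan : ℕ → ℕ
catalan m = ((2 * m) C m) / suc m

-- A street is given by its set of occupied spots.
Street : ℕ → Set
Street = Subset

firstFree : ∀ {m} → Street m → Maybe (Fin m)
firstFree []            = nothing
firstFree (outside ∷ s) = just zero
firstFree (inside  ∷ s) = mapᴹ suc (firstFree s)

-- The first free spot that is the given preference or comes after it.
parkingSpot : ∀ {m} → Street m → Fin m → Maybe (Fin m)
parkingSpot s       zero    = firstFree s
parkingSpot (_ ∷ s) (suc a) = mapᴹ suc (parkingSpot s a)

occupy : ∀ {m} → Street m → Maybe (Fin m) → Street m
occupy s nothing  = s
occupy s (just p) = s [ p ]≔ inside

parkFrom : ∀ {m k} → Street m → Vec (Fin m) k → Vec (Maybe (Fin m)) k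
parkFrom s []       = []
parkFrom s (a ∷ as) = parkingSpot s a ∷ parkFrom (occupy s (parkingSpot s a)) as

Preferences : ℕ → Set
Preferences n = Vec (Fin n) n

-- Entry i is the spot in which car i parks, or nothing if it fails to park.
outcome : ∀ {n} → Preferences n → Vec (Maybe (Fin n)) n
outcome = parkFrom ⊥

IsParkingFunction : ∀ {n} → Pred (Preferences n) 0ℓ
IsParkingFunction a = All Is-just (outcome a)

WeaklyIncreasing : ∀ {n} → Pred (Preferences n) 0ℓ
WeaklyIncreasing = Linked _≤ᶠ_

WIPF : ∀ {n} → Pred (Preferences n) 0ℓ
WIPF a = WeaklyIncreasing a × IsParkingFunction a

Prefers : ∀ {n} → Fin n → Fin n → Pred (Preferences n) 0ℓ
Prefers i j a = lookup a i ≡ j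

ParksIn : ∀ {n} → Fin n → Fin n → Pred (Preferences n) 0ℓ
ParksIn i j a = lookup (outcome a) i ≡ just j

LuckyCar : ∀ {n} → Fin n → Pred (Preferences n) 0ℓ
LuckyCar i a = ParksIn i (lookup a i) a

LuckySpot : ∀ {n} → Fin n → Pred (Preferences n) 0ℓ
LuckySpot j a = ∃[ i ] ParksIn i j a × Prefers i j a

wipf? : ∀ {n} → Decidable (WIPF {n})
wipf? a = linked? _≤?_ a ×-dec all? (MaybeAny.dec (λ _ → yes tt)) (outcome a)

prefers? : ∀ {n} (i j : Fin n) → Decidable (Prefers i j)
prefers? i j a = lookup a i ≟ j

parksIn? : ∀ {n} (i j : Fin n) → Decidable (ParksIn i j)
parksIn? i j a = ≡-dec _≟_ (lookup (outcome a) i) (just j)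

luckyCar? : ∀ {n} (i : Fin n) → Decidable (LuckyCar i)
luckyCar? i a = parksIn? i (lookup a i) a

luckySpot? : ∀ {n} (j : Fin n) → Decidable (LuckySpot j)
luckySpot? j a = any? λ i → parksIn? i j a ×-dec prefers? i j a

allVecs : ∀ m k → List (Vec (Fin m) k)
allVecs m zero    = List.[ [] ]
allVecs m (suc k) = cartesianProductWith _∷_ (allFin m) (allVecs m k)

-- allVecs lists every vector exactly once, so that filtering it counts.
∈-allVecs : ∀ {m k} (v : Vec (Fin m) k) → v ∈ allVecs m k
∈-allVecs []      = here refl
∈-allVecs (x ∷ v) = ∈-cartesianProductWith⁺ _∷_ (∈-allFin x) (∈-allVecs v)

allVecs-unique : ∀ m k → Unique (allVecs m k)
allVecs-unique m zero    = ListAll.[] ∷ []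
allVecs-unique m (suc k) =
  cartesianProductWith⁺ _∷_ ∷-injective (allFin⁺ m) (allVecs-unique m k)

count : ∀ {n} {P : Pred (Preferences n) 0ℓ} → Decidable P → ℕ
count {n} P? = length (filter P? (allVecs n n))

q : ∀ n → Fin n → Fin n → ℕ
q n i j = count {n} λ a → wipf? a ×-dec prefers? i j a ×-dec luckyCar? i a

luckyCarCount : ∀ n → Fin n → ℕ
luckyCarCount n i = count {n} λ a → wipf? a ×-dec luckyCar? i a

luckySpotCount : ∀ n → Fin n → ℕ
luckySpotCount n i = count {n} λ a → wipf? a ×-dec luckySpot? i a

{-# OPTIONS --safe #-}
-- A weakly increasing sequence (numbered from 0) is a parking function iff
-- a_k ≤ k for all k: a first violation a_k > k leaves spot k free for ever.
-- Car k then parks in spot k, so lucky cars, lucky spots and fixed points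
-- a_i = i coincide. A fixed point at i splits the sequence into two
-- independent ones: the i terms before it, and the n − i terms from i onwards,
-- shifted down by i. Such sequences are counted by ballot numbers.
module Submission where

open import Defs
open import Algebra.Properties.CommutativeSemigroup using (interchange)
open import Data.Bool.Base using (if_then_else_)
open import Data.Empty using (⊥-elim)
open import Data.Fin.Base using (Fin; zero; suc; toℕ; fromℕ<)
open import Data.Fin.Properties using (_≟_; toℕ-fromℕ<; toℕ-injective)
open import Data.Fin.Subset using (inside; outside; ⊥)
open import Data.List.Base using ([]; _∷_; _++_; allFin; cartesianProductWith; filter; length; map; tabulate)
open import Data.List.Properties using (filter-++; filter-none; filter-≐; length-++; map-tabulate)
import Data.List.Relation.Unary.All as ListAll
open import Data.Maybe.Base using (just) renaming (map to mapᴹ)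
open import Data.Maybe using (Is-just)
open import Data.Maybe.Properties using (just-injective)
import Data.Maybe.Relation.Unary.Any as MaybeAny
open import Data.Nat.Base using (ℕ; zero; suc; _+_; _*_; _∸_; _/_; _≤_; _<_; z≤n; s≤s; s≤s⁻¹)
open import Data.Nat.Combinatorics using (_C_; nCk≡nC[n∸k]; nCn≡1; nC1≡n; k>n⇒nCk≡0; nCk+nC[k+1]≡[n+1]C[k+1])
open import Data.Nat.DivMod using (m*n/n≡m)
open import Data.Nat.ListAction using (sum)
import Data.Nat.Properties as ℕ
open import Data.Nat.Tactic.RingSolver using (solve-∀)
open import Data.Product.Base using (_×_; _,_; proj₁; proj₂)
open import Data.Unit.Base using (⊤; tt)
open import Data.Vec.Base using (Vec; []; _∷_; lookup; _[_]≔_)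
open import Data.Vec.Relation.Unary.All as All using (All; []; _∷_)
open import Data.Vec.Relation.Unary.Linked as Linked using (Linked; []; [-]; _∷_)
open import Data.Vec.Relation.Unary.Linked.Properties using (Linked⇒All)
open import Function.Base using (_∘_; id)
open import Level using (0ℓ)
open import Relation.Binary.PropositionalEquality
open import Relation.Nullary.Decidable using (does; yes; no; _×-dec_)
open import Relation.Nullary.Negation using (¬_)
open import Relation.Unary using (Pred; Decidable)

open ≡-Reasoning

-- Ballot numbers

sumTo : (ℕ → ℕ) → ℕ → ℕ
sumTo g zero    = g zero
sumTo g (suc d) = g (suc d) + sumTo g d

sumTo-*ʳ : ∀ g c d → sumTo (λ e → g e * c) d ≡ sumTo g d * c
sumTo-*ʳ g c zero    = refl
sumTo-*ʳ g c (suc d) = trans (cong (g (suc d) * c +_) (sumTo-*ʳ g c d))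
                             (sym (ℕ.*-distribʳ-+ c (g (suc d)) (sumTo g d)))

-- The number of weakly increasing sequences b of k naturals with b_j ≤ d + j;
-- the summand e of the recursion stands for b_0 = d − e.
ballot : ℕ → ℕ → ℕ
ballot zero    d = 1
ballot (suc k) d = sumTo (ballot k ∘ suc) d

nC0≡1 : ∀ n → n C 0 ≡ 1
nC0≡1 n = trans (nCk≡nC[n∸k] {n = n} z≤n) (nCn≡1 n)

-- n C (k − 1), with value 0 for k = 0.
_C⁻_ : ℕ → ℕ → ℕ
n C⁻ zero  = 0
n C⁻ suc k = n C k

pascal⁻ : ∀ n k → n C⁻ k + n C k ≡ suc n C k
pascal⁻ n zero    = trans (nC0≡1 n) (sym (nC0≡1 (suc n)))
pascal⁻ n (suc k) = nCk+nC[k+1]≡[n+1]C[k+1] n k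

-- The reflection principle: a ballot number is a difference of two neighbouring binomials, written
-- with a sum to avoid truncated subtraction. Unfolding gives `ballot (suc k) (suc d)` =
-- `ballot k (2 + d) + ballot (suc k) d`, and Pascal's rule gives the binomials the same recursion.
ballot-reflection : ∀ k d → ballot k d + (2 * k + d) C⁻ k ≡ (2 * k + d) C k
ballot-reflection zero    d       = sym (nC0≡1 d)
ballot-reflection (suc k) zero    = begin
  b + (2 * suc k + 0) C k          ≡⟨ cong (λ z → b + z C k) (eq k) ⟩
  b + suc N C k                    ≡⟨ cong (b +_) (pascal⁻ N k) ⟨
  b + (N C⁻ k + N C k)             ≡⟨ ℕ.+-assoc b _ _ ⟨
  b + N C⁻ k + N C k               ≡⟨ cong (_+ N C k) (ballot-reflection k 1) ⟩
  -- On the boundary `d = 0` the row `N = 2k + 1` is odd, so its two middle binomials agree; this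
  -- replaces the missing second summand.
  N C k + N C k                    ≡⟨ cong (N C k +_) symmetric ⟩
  N C k + N C suc k                ≡⟨ nCk+nC[k+1]≡[n+1]C[k+1] N k ⟩
  suc N C suc k                    ≡⟨ cong (_C suc k) (eq k) ⟨
  (2 * suc k + 0) C suc k          ∎
  where
  N = 2 * k + 1
  b = ballot k 1
  eq : ∀ k → 2 * suc k + 0 ≡ suc (2 * k + 1)
  eq = solve-∀
  N≡ : ∀ k → 2 * k + 1 ≡ k + suc k
  N≡ = solve-∀
  symmetric : N C k ≡ N C suc k
  symmetric = trans (nCk≡nC[n∸k] (subst (k ≤_) (sym (N≡ k)) (ℕ.m≤m+n k (suc k))))
                    (cong (N C_) (trans (cong (_∸ k) (N≡ k)) (ℕ.m+n∸m≡n k (suc k))))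
ballot-reflection (suc k) (suc d) = begin
  (b₁ + b₂) + (2 * suc k + suc d) C k          ≡⟨ cong (λ z → (b₁ + b₂) + z C k) (eq₁ k d) ⟩
  (b₁ + b₂) + suc N C k                        ≡⟨ cong ((b₁ + b₂) +_) (pascal⁻ N k) ⟨
  (b₁ + b₂) + (N C⁻ k + N C k)                 ≡⟨ interchange ℕ.+-commutativeSemigroup b₁ b₂ _ _ ⟩
  (b₁ + N C⁻ k) + (b₂ + N C k)                 ≡⟨ cong₂ _+_ (ballot-reflection k (2 + d))
                                                   (subst (λ z → b₂ + z C k ≡ z C suc k) (eq₂ k d) (ballot-reflection (suc k) d)) ⟩
  N C k + N C suc k                            ≡⟨ nCk+nC[k+1]≡[n+1]C[k+1] N k ⟩
  suc N C suc k                                ≡⟨ cong (_C suc k) (eq₁ k d) ⟨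
  (2 * suc k + suc d) C suc k                  ∎
  where
  N = 2 * k + (2 + d)
  b₁ = ballot k (2 + d)
  b₂ = ballot (suc k) d
  eq₁ : ∀ k d → 2 * suc k + suc d ≡ suc (2 * k + (2 + d))
  eq₁ = solve-∀
  eq₂ : ∀ k d → 2 * suc k + d ≡ 2 * k + (2 + d)
  eq₂ = solve-∀

-- (k + 1) (n C (k + 1)) = (n − k) (n C k), without subtraction.
C-absorption : ∀ n k → suc k * (n C suc k) + k * (n C k) ≡ n * (n C k)
C-absorption zero    zero    = refl
C-absorption zero    (suc k)
  rewrite k>n⇒nCk≡0 {0} {suc k} (s≤s z≤n) | k>n⇒nCk≡0 {0} {suc (suc k)} (s≤s z≤n)
        | ℕ.*-zeroʳ k = refl
C-absorption (suc n) zero    = begin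
  1 * (suc n C 1) + 0   ≡⟨ trans (ℕ.+-identityʳ _) (ℕ.*-identityˡ _) ⟩
  suc n C 1             ≡⟨ nC1≡n (suc n) ⟩
  suc n                 ≡⟨ ℕ.*-identityʳ (suc n) ⟨
  suc n * 1             ≡⟨ cong (suc n *_) (nC0≡1 (suc n)) ⟨
  suc n * (suc n C 0)   ∎
C-absorption (suc n) (suc k) = begin
  (2 + k) * (suc n C (2 + k)) + suc k * (suc n C suc k)
    ≡⟨ cong₂ (λ x y → (2 + k) * x + suc k * y) (nCk+nC[k+1]≡[n+1]C[k+1] n (suc k)) (nCk+nC[k+1]≡[n+1]C[k+1] n k) ⟨
  (2 + k) * (B + A) + suc k * (D + B)
    ≡⟨ regroup k A B D ⟩
  ((2 + k) * A + suc k * B) + (suc k * B + k * D) + (B + D)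
    ≡⟨ cong₂ (λ x y → x + y + (B + D)) (C-absorption n (suc k)) (C-absorption n k) ⟩
  n * B + n * D + (B + D)
    ≡⟨ factor n B D ⟩
  suc n * (D + B)
    ≡⟨ cong (suc n *_) (nCk+nC[k+1]≡[n+1]C[k+1] n k) ⟩
  suc n * (suc n C suc k) ∎
  where
  A = n C (2 + k)
  B = n C suc k
  D = n C k
  regroup : ∀ k a b d → (2 + k) * (b + a) + suc k * (d + b) ≡ ((2 + k) * a + suc k * b) + (suc k * b + k * d) + (b + d)
  regroup = solve-∀
  factor : ∀ n b d → n * b + n * d + (b + d) ≡ suc n * (d + b)
  factor = solve-∀

-- `C-absorption` in row `2m` at column `m − 1`. It expresses the subtracted binomial of the
-- reflection formula through the central one.
central-C⁻ : ∀ m → suc m * ((2 * m) C⁻ m) ≡ m * ((2 * m) C m)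
central-C⁻ zero    = refl
central-C⁻ (suc k) = ℕ.+-cancelʳ-≡ (k * D) _ _ (begin
  (2 + k) * D + k * D                      ≡⟨ eq k D ⟩
  (2 * suc k) * D                          ≡⟨ C-absorption (2 * suc k) k ⟨
  suc k * ((2 * suc k) C suc k) + k * D    ∎)
  where
  D = (2 * suc k) C k
  eq : ∀ k d → (2 + k) * d + k * d ≡ (2 * suc k) * d
  eq = solve-∀

ballot≡catalan : ∀ m → ballot m 0 ≡ catalan m
ballot≡catalan m = begin
  b                    ≡⟨ m*n/n≡m b (suc m) ⟨
  (b * suc m) / suc m  ≡⟨ cong (_/ suc m) (trans (ℕ.*-comm b (suc m)) exact) ⟩
  catalan m            ∎
  where
  b = ballot m 0
  N = 2 * m
  reflection : b + N C⁻ m ≡ N C m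
  reflection = subst (λ z → b + z C⁻ m ≡ z C m) (ℕ.+-identityʳ N) (ballot-reflection m 0)
  exact : suc m * b ≡ N C m
  -- Multiply the reflection formula by `suc m`. The term added on both sides is what `central-C⁻`
  -- makes of `suc m * (N C⁻ m)`.
  exact = ℕ.+-cancelʳ-≡ (m * (N C m)) _ _ (begin
    suc m * b + m * (N C m)         ≡⟨ cong (suc m * b +_) (central-C⁻ m) ⟨
    suc m * b + suc m * (N C⁻ m)    ≡⟨ ℕ.*-distribˡ-+ (suc m) b _ ⟨
    suc m * (b + N C⁻ m)            ≡⟨ cong (suc m *_) reflection ⟩
    N C m + m * (N C m)             ∎)

-- Counting vectors

-- Extends `count`, the case `m = k = n`, to vectors of any length, so that induction can pass to
-- tails over the same set of spots.
card : ∀ {m k} {P : Pred (Vec (Fin m) k) 0ℓ} → Decidable P → ℕ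
card {m} {k} P? = length (filter P? (allVecs m k))

card-≐ : ∀ {m k} {P Q : Pred (Vec (Fin m) k) 0ℓ} (P? : Decidable P) (Q? : Decidable Q) →
  (∀ v → P v → Q v) → (∀ v → Q v → P v) → card P? ≡ card Q?
card-≐ {m} {k} P? Q? P⇒Q Q⇒P = cong length (filter-≐ P? Q? ((λ {v} → P⇒Q v) , (λ {v} → Q⇒P v)) (allVecs m k))

card-none : ∀ {m k} {P : Pred (Vec (Fin m) k) 0ℓ} (P? : Decidable P) → (∀ v → ¬ P v) → card P? ≡ 0
card-none {m} {k} P? ¬P = cong length (filter-none P? {allVecs m k} (ListAll.tabulate (λ {v} _ → ¬P v)))

length-filter-map : ∀ {A B : Set} {P : Pred B 0ℓ} (P? : Decidable P) (f : A → B) xs →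
  length (filter P? (map f xs)) ≡ length (filter (P? ∘ f) xs)
length-filter-map P? f []       = refl
length-filter-map P? f (x ∷ xs) with P? (f x)
... | yes _ = cong suc (length-filter-map P? f xs)
... | no  _ = length-filter-map P? f xs

length-filter-cartesianProductWith : ∀ {A B E : Set} {P : Pred E 0ℓ} (P? : Decidable P) (f : A → B → E) xs ys →
  length (filter P? (cartesianProductWith f xs ys)) ≡ sum (map (λ x → length (filter (P? ∘ f x) ys)) xs)
length-filter-cartesianProductWith P? f []       ys = refl
length-filter-cartesianProductWith P? f (x ∷ xs) ys = begin
  length (filter P? (map (f x) ys ++ rest))                     ≡⟨ cong length (filter-++ P? (map (f x) ys) rest) ⟩
  length (filter P? (map (f x) ys) ++ filter P? rest)           ≡⟨ length-++ (filter P? (map (f x) ys)) ⟩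
  length (filter P? (map (f x) ys)) + length (filter P? rest)
    ≡⟨ cong₂ _+_ (length-filter-map P? (f x) ys) (length-filter-cartesianProductWith P? f xs ys) ⟩
  length (filter (P? ∘ f x) ys) + sum (map (λ x → length (filter (P? ∘ f x) ys)) xs) ∎
  where rest = cartesianProductWith f xs ys

card-∷ : ∀ {m k} {P : Pred (Vec (Fin m) (suc k)) 0ℓ} (P? : Decidable P) →
  card P? ≡ sum (tabulate (λ x → card (λ v → P? (x ∷ v))))
card-∷ {m} {k} P? = trans (length-filter-cartesianProductWith P? _∷_ (allFin m) (allVecs m k))
                          (cong sum (map-tabulate {n = m} id (λ x → card (λ v → P? (x ∷ v)))))

sum-tabulate-0 : ∀ {m} (h : Fin m → ℕ) → (∀ x → h x ≡ 0) → sum (tabulate h) ≡ 0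
sum-tabulate-0 {zero}  h h≡0 = refl
sum-tabulate-0 {suc m} h h≡0 = cong₂ _+_ (h≡0 zero) (sum-tabulate-0 (h ∘ suc) (h≡0 ∘ suc))

-- The summands vanish off the interval from `l` to `t`, and `e` measures the distance down from
-- `t`. Once the `l` leading zeros are dropped, the lowest position carries the largest `e`, which
-- is the term that `sumTo` peels off first.
sum-tabulate-interval : ∀ {m} l d t (h : Fin m → ℕ) (g : ℕ → ℕ) → t ≡ l + d → t < m →
  (∀ x e → l ≤ toℕ x → toℕ x + e ≡ t → h x ≡ g e) →
  (∀ x → ¬ (l ≤ toℕ x × toℕ x ≤ t) → h x ≡ 0) →
  sum (tabulate h) ≡ sumTo g d
sum-tabulate-interval {suc m} (suc l) d t h g refl (s≤s t<m) in-range out-of-range =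
  cong₂ _+_ (out-of-range zero λ ())
    (sum-tabulate-interval l d (l + d) (h ∘ suc) g refl t<m
      (λ x e l≤x eq → in-range (suc x) e (s≤s l≤x) (cong suc eq))
      (λ x ¬r → out-of-range (suc x) λ (l≤x , x≤t) → ¬r (s≤s⁻¹ l≤x , s≤s⁻¹ x≤t)))
sum-tabulate-interval {suc m} zero zero t h g refl t<m in-range out-of-range =
  trans (cong₂ _+_ (in-range zero 0 z≤n refl)
          (sum-tabulate-0 (h ∘ suc) λ x → out-of-range (suc x) λ ()))
        (ℕ.+-identityʳ (g 0))
sum-tabulate-interval {suc m} zero (suc d) t h g refl (s≤s t<m) in-range out-of-range =
  cong₂ _+_ (in-range zero (suc d) z≤n refl)
    (sum-tabulate-interval zero d d (h ∘ suc) g refl t<m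
      (λ x e _ eq → in-range (suc x) e z≤n (cong suc eq))
      (λ x ¬r → out-of-range (suc x) λ (_ , x≤t) → ¬r (z≤n , s≤s⁻¹ x≤t)))

-- Counting staircase sequences

-- Weakly increasing with all entries at least l and the k-th at most t + k.
Staircase : ∀ {m k} → ℕ → ℕ → Pred (Vec (Fin m) k) 0ℓ
Staircase l t []      = ⊤
Staircase l t (x ∷ v) = (l ≤ toℕ x × toℕ x ≤ t) × Staircase (toℕ x) (suc t) v

staircase? : ∀ {m k} l t → Decidable (Staircase {m} {k} l t)
staircase? l t []      = yes tt
staircase? l t (x ∷ v) = (l ℕ.≤? toℕ x ×-dec toℕ x ℕ.≤? t) ×-dec staircase? (toℕ x) (suc t) v

suc-bound : ∀ {m} t k → t + suc k ≤ m → t < m × suc t + k ≤ m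
suc-bound {m} t k b = ℕ.≤-trans (s≤s (ℕ.m≤m+n t k)) b′ , b′
  where b′ = subst (_≤ m) (ℕ.+-suc t k) b

slack : ∀ x e {t} → x + e ≡ t → suc t ≡ x + suc e
slack x e eq = trans (cong suc (sym eq)) (sym (ℕ.+-suc x e))

-- A first entry `x = t − e` leaves a staircase with lower bound `x` and upper bound `t + 1`, hence
-- of gap `e + 1`: the ballot recursion. By `t + k ≤ m` the size of the alphabet never cuts off an
-- admissible entry.
card-staircase : ∀ {m} k l d t → t ≡ l + d → t + k ≤ m → card {m} {k} (staircase? l t) ≡ ballot k d
card-staircase     zero    l d t _    _     = refl
card-staircase {m} (suc k) l d t t≡l+d bound =
  trans (card-∷ {m} {k} (staircase? l t))
    (sum-tabulate-interval l d t _ (ballot k ∘ suc) t≡l+d t<m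
      (λ x e l≤x eq →
        trans (card-≐ {m} {k} _ (staircase? (toℕ x) (suc t)) (λ _ → proj₂)
                (λ _ s → (l≤x , subst (toℕ x ≤_) eq (ℕ.m≤m+n (toℕ x) e)) , s))
              (card-staircase k (toℕ x) (suc e) (suc t) (slack (toℕ x) e eq) bound′))
      (λ x ¬r → card-none {m} {k} _ λ _ (r , _) → ¬r r))
  where
  t<m = proj₁ (suc-bound t k bound)
  bound′ = proj₂ (suc-bound t k bound)

StaircaseThrough : ∀ {m k} → ℕ → ℕ → Fin k → Fin m → Pred (Vec (Fin m) k) 0ℓ
StaircaseThrough l t i j v = Staircase l t v × lookup v i ≡ j

staircaseThrough? : ∀ {m k} l t (i : Fin k) (j : Fin m) → Decidable (StaircaseThrough l t i j)
staircaseThrough? l t i j v = staircase? l t v ×-dec lookup v i ≟ j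

-- The entry at i attains its bound t + i.
card-staircaseThrough : ∀ {m} k l d t (i : Fin k) (j : Fin m) → t ≡ l + d → t + k ≤ m → toℕ j ≡ t + toℕ i →
  card (staircaseThrough? l t i j) ≡ ballot (toℕ i) d * ballot (k ∸ toℕ i) 0
card-staircaseThrough {m} (suc k) l d t zero j t≡l+d bound j≡t+0 =
  trans (card-∷ {m} {k} (staircaseThrough? l t zero j))
    -- The first entry must be `t`, so the interval shrinks to one point. The tail then has gap 1,
    -- and `ballot k 1` is `ballot (suc k) 0` by definition.
    (trans (sum-tabulate-interval t 0 t _ (λ _ → ballot k 1) (sym (ℕ.+-identityʳ t)) t<m
             at-t
             (λ x ¬r → card-none {m} {k} _ λ _ (_ , x≡j) → ¬r (not-at-t x x≡j)))
           (sym (ℕ.*-identityˡ (ballot k 1))))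
  where
  t<m = proj₁ (suc-bound t k bound)
  bound′ = proj₂ (suc-bound t k bound)
  j≡t : toℕ j ≡ t
  j≡t = trans j≡t+0 (ℕ.+-identityʳ t)
  l≤t : l ≤ t
  l≤t = subst (l ≤_) (sym t≡l+d) (ℕ.m≤m+n l d)
  at-t : ∀ x e → t ≤ toℕ x → toℕ x + e ≡ t →
    card {m} {k} (λ v → staircaseThrough? l t zero j (x ∷ v)) ≡ ballot k 1
  at-t x e t≤x eq =
    trans (card-≐ {m} {k} _ (staircase? (toℕ x) (suc t)) (λ _ → proj₂ ∘ proj₁)
            (λ _ s → ((ℕ.≤-trans l≤t t≤x , x≤t) , s) , toℕ-injective (trans x≡t (sym j≡t))))
          (card-staircase k (toℕ x) 1 (suc t) (slack (toℕ x) 0 (trans (ℕ.+-identityʳ _) x≡t)) bound′)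
    where
    x≤t = subst (toℕ x ≤_) eq (ℕ.m≤m+n (toℕ x) e)
    x≡t = ℕ.≤-antisym x≤t t≤x
  not-at-t : ∀ x → x ≡ j → t ≤ toℕ x × toℕ x ≤ t
  not-at-t x refl = ℕ.≤-reflexive (sym j≡t) , ℕ.≤-reflexive j≡t
card-staircaseThrough {m} (suc k) l d t (suc i) j t≡l+d bound j≡t+i =
  trans (card-∷ {m} {k} (staircaseThrough? l t (suc i) j))
    -- The factor `c` for the part from the fixed position onwards is the same for every first
    -- entry, so it comes out of the sum.
    (trans (sum-tabulate-interval l d t _ (λ e → ballot (toℕ i) (suc e) * c) t≡l+d t<m
             (λ x e l≤x eq →
               trans (card-≐ {m} {k} _ (staircaseThrough? (toℕ x) (suc t) i j)
                       (λ _ ((_ , s) , p) → s , p)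
                       (λ _ (s , p) → ((l≤x , subst (toℕ x ≤_) eq (ℕ.m≤m+n (toℕ x) e)) , s) , p))
                     (card-staircaseThrough k (toℕ x) (suc e) (suc t) i j (slack (toℕ x) e eq) bound′
                       (trans j≡t+i (ℕ.+-suc t (toℕ i)))))
             (λ x ¬r → card-none {m} {k} _ λ _ ((r , _) , _) → ¬r r))
           (sumTo-*ʳ (ballot (toℕ i) ∘ suc) c d))
  where
  c = ballot (k ∸ toℕ i) 0
  t<m = proj₁ (suc-bound t k bound)
  bound′ = proj₂ (suc-bound t k bound)

-- Parking

-- The state of the street after `t` cars when each car k has parked in spot k.
firstSpots : ∀ m → ℕ → Street m
firstSpots zero    t       = []
firstSpots (suc m) zero    = outside ∷ firstSpots m zero
firstSpots (suc m) (suc t) = inside ∷ firstSpots m t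

firstSpots-0 : ∀ m → firstSpots m 0 ≡ ⊥
firstSpots-0 zero    = refl
firstSpots-0 (suc m) = cong (outside ∷_) (firstSpots-0 m)

firstFree-firstSpots : ∀ {m} (p : Fin m) → firstFree (firstSpots m (toℕ p)) ≡ just p
firstFree-firstSpots zero    = refl
firstFree-firstSpots (suc p) = cong (mapᴹ suc) (firstFree-firstSpots p)

parkingSpot-firstSpots : ∀ {m} (a p : Fin m) → toℕ a ≤ toℕ p → parkingSpot (firstSpots m (toℕ p)) a ≡ just p
parkingSpot-firstSpots zero    p       _   = firstFree-firstSpots p
parkingSpot-firstSpots (suc a) (suc p) a≤p = cong (mapᴹ suc) (parkingSpot-firstSpots a p (s≤s⁻¹ a≤p))

firstSpots-occupy : ∀ {m} (p : Fin m) → firstSpots m (toℕ p) [ p ]≔ inside ≡ firstSpots m (suc (toℕ p))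
firstSpots-occupy {suc m} zero    = refl
firstSpots-occupy {suc m} (suc p) = cong (inside ∷_) (firstSpots-occupy p)

free≥ : ∀ {m} → ℕ → Street m → ℕ
free≥ c       []            = 0
free≥ zero    (outside ∷ s) = suc (free≥ zero s)
free≥ zero    (inside ∷ s)  = free≥ zero s
free≥ (suc c) (_ ∷ s)       = free≥ c s

free≥-≤ : ∀ {m} c (s : Street m) → free≥ c s ≤ m ∸ c
free≥-≤ zero    []            = z≤n
free≥-≤ (suc c) []            = z≤n
free≥-≤ zero    (outside ∷ s) = s≤s (free≥-≤ zero s)
free≥-≤ zero    (inside ∷ s)  = ℕ.m≤n⇒m≤1+n (free≥-≤ zero s)
free≥-≤ (suc c) (_ ∷ s)       = free≥-≤ c s

free≥-firstFree : ∀ {m} (s : Street m) {p} → firstFree s ≡ just p → free≥ 0 s ≡ suc (free≥ 0 (s [ p ]≔ inside))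
free≥-firstFree (outside ∷ s) refl = refl
free≥-firstFree (inside ∷ s)  eq with firstFree s in eq′
free≥-firstFree (inside ∷ s)  refl | just p = free≥-firstFree s eq′

-- A car never parks before its preference, so a car that prefers a spot from `c` on and parks uses
-- up exactly one of the counted spots.
free≥-parkingSpot : ∀ {m} c (s : Street m) a {p} → c ≤ toℕ a → parkingSpot s a ≡ just p →
  free≥ c s ≡ suc (free≥ c (s [ p ]≔ inside))
free≥-parkingSpot zero    s             zero    _   eq = free≥-firstFree s eq
free≥-parkingSpot c       (b ∷ s)       (suc a) c≤a eq with parkingSpot s a in eq′
free≥-parkingSpot zero    (outside ∷ s) (suc a) _   refl | just p = cong suc (free≥-parkingSpot zero s a z≤n eq′)
free≥-parkingSpot zero    (inside ∷ s)  (suc a) _   refl | just p = free≥-parkingSpot zero s a z≤n eq′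
free≥-parkingSpot (suc c) (b ∷ s)       (suc a) c≤a refl | just p = free≥-parkingSpot c s a (s≤s⁻¹ c≤a) eq′

-- Pigeonhole: each of these cars takes a different free spot from `c` on.
parked≤free≥ : ∀ {m k} c (s : Street m) (v : Vec (Fin m) k) → All (λ a → c ≤ toℕ a) v →
  All Is-just (parkFrom s v) → k ≤ free≥ c s
parked≤free≥ c s []      _           _          = z≤n
parked≤free≥ c s (a ∷ v) (c≤a ∷ c≤v) (j ∷ js) with parkingSpot s a in eq
... | just p = subst (_ ≤_) (sym (free≥-parkingSpot c s a c≤a eq))
                 (s≤s (parked≤free≥ c (s [ p ]≔ inside) v c≤v js))

-- Weakly increasing parking functions as staircases

module _ {m : ℕ} where
  parkFrom-firstSpots : ∀ {k} (a p : Fin m) (v : Vec (Fin m) k) → toℕ a ≤ toℕ p →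
    parkFrom (firstSpots m (toℕ p)) (a ∷ v) ≡ just p ∷ parkFrom (firstSpots m (suc (toℕ p))) v
  parkFrom-firstSpots a p v a≤p
    rewrite parkingSpot-firstSpots a p a≤p | firstSpots-occupy p = refl

  staircase⇒linked : ∀ {k l t} (v : Vec (Fin m) k) → Staircase l t v → Linked (λ x y → toℕ x ≤ toℕ y) v
  staircase⇒linked []          _                    = []
  staircase⇒linked (x ∷ [])    _                    = [-]
  staircase⇒linked (x ∷ y ∷ v) (_ , s@((x≤y , _) , _)) = x≤y ∷ staircase⇒linked (y ∷ v) s

  -- When exactly the first `t` spots are taken, a preference of at most `t` leads to spot `t`, and
  -- the street keeps this shape. Spot `t` exists because `t + k ≡ m` and a car remains.
  parkFrom-staircase : ∀ {k l} t (v : Vec (Fin m) k) → t + k ≡ m → Staircase l t v →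
    All Is-just (parkFrom (firstSpots m t) v)
    × (∀ i j → toℕ j ≡ t + toℕ i → lookup (parkFrom (firstSpots m t) v) i ≡ just j)
  parkFrom-staircase t [] _ _ = [] , λ ()
  parkFrom-staircase {suc k} t (x ∷ v) eq ((_ , x≤t) , s)
    -- `p` is spot `t` as an element of `Fin m`; matching on `refl` replaces `t` by `toℕ p`, the
    -- form in which `parkFrom-firstSpots` applies.
    with fromℕ< t<m | toℕ-fromℕ< t<m
    where t<m = proj₁ (suc-bound t k (ℕ.≤-reflexive eq))
  ... | p | refl
    with parkFrom-staircase (suc t) v (trans (sym (ℕ.+-suc t k)) eq) s
  ... | js , at rewrite parkFrom-firstSpots x p v x≤t = MaybeAny.just tt ∷ js , at′
    where
    at′ : ∀ i j → toℕ j ≡ t + toℕ i → lookup (just p ∷ parkFrom (firstSpots m (suc t)) v) i ≡ just j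
    at′ zero    j j≡ = cong just (toℕ-injective (sym (trans j≡ (ℕ.+-identityʳ t))))
    at′ (suc i) j j≡ = at i j (trans j≡ (ℕ.+-suc t (toℕ i)))

  linked⇒staircase : ∀ {k l} t (v : Vec (Fin m) k) → t + k ≡ m → Linked (λ x y → toℕ x ≤ toℕ y) v →
    All (λ x → l ≤ toℕ x) v → All Is-just (parkFrom (firstSpots m t) v) → Staircase l t v
  linked⇒staircase t [] _ _ _ _ = tt
  linked⇒staircase {suc k} t (x ∷ v) eq inc (l≤x ∷ _) js with toℕ x ℕ.≤? t
  -- If the first remaining car prefers a spot beyond `t`, so do all later ones by monotonicity.
  -- Then `suc k` cars compete for the at most `m ∸ suc t`, that is `k`, free spots there.
  ... | no x≰t = ⊥-elim (ℕ.1+n≰n (ℕ.≤-trans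
      (parked≤free≥ (suc t) _ (x ∷ v) (All.map (ℕ.≤-trans (ℕ.≰⇒> x≰t)) x≤) js)
      (ℕ.≤-trans (free≥-≤ (suc t) (firstSpots m t)) (ℕ.≤-reflexive m∸[1+t]≡k))))
    where
    x≤ : All (λ y → toℕ x ≤ toℕ y) (x ∷ v)
    x≤ = Linked⇒All ℕ.≤-trans ℕ.≤-refl inc
    m∸[1+t]≡k : m ∸ suc t ≡ k
    m∸[1+t]≡k = trans (cong (_∸ suc t) (trans (sym eq) (ℕ.+-suc t k))) (ℕ.m+n∸m≡n t k)
  ... | yes x≤t
    with fromℕ< t<m | toℕ-fromℕ< t<m
    where t<m = proj₁ (suc-bound t k (ℕ.≤-reflexive eq))
  ... | p | refl rewrite parkFrom-firstSpots x p v x≤t =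
    (l≤x , x≤t) , linked⇒staircase (suc t) v (trans (sym (ℕ.+-suc t k)) eq) (Linked.tail inc)
                    (All.tail (Linked⇒All ℕ.≤-trans ℕ.≤-refl inc)) (All.tail js)

-- Lucky cars and lucky spots as fixed points

module _ {n : ℕ} where
  WIPF⇒staircase : (a : Preferences n) → WIPF a → Staircase 0 0 a
  WIPF⇒staircase a (inc , js) =
    linked⇒staircase 0 a refl inc (All.universal (λ _ → z≤n) a)
      (subst (λ s → All Is-just (parkFrom s a)) (sym (firstSpots-0 n)) js)

  staircase⇒WIPF : (a : Preferences n) → Staircase 0 0 a → WIPF a
  staircase⇒WIPF a s =
    staircase⇒linked a s ,
    subst (λ s → All Is-just (parkFrom s a)) (firstSpots-0 n) (proj₁ (parkFrom-staircase 0 a refl s))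

  WIPF-parksIn : (a : Preferences n) → WIPF a → ∀ i → ParksIn i i a
  WIPF-parksIn a w i =
    subst (λ s → lookup (parkFrom s a) i ≡ just i) (firstSpots-0 n)
      (proj₂ (parkFrom-staircase 0 a refl (WIPF⇒staircase a w)) i i refl)

  parksIn-unique : (a : Preferences n) → WIPF a → ∀ {i j} → ParksIn i j a → i ≡ j
  parksIn-unique a w {i} p = just-injective (trans (sym (WIPF-parksIn a w i)) p)

  prefers⇒lucky : (a : Preferences n) → WIPF a → ∀ {i} → Prefers i i a → LuckyCar i a
  prefers⇒lucky a w {i} pref = trans (WIPF-parksIn a w i) (cong just (sym pref))

  -- All nonzero counts reduce to this one: it applies to any property equivalent to being a weakly
  -- increasing parking function with a fixed point at `i`. As `i` is counted from 0, `toℕ i` and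
  -- `n ∸ toℕ i` are i - 1 and n - i + 1 in the usual numbering.
  count-fixed : ∀ i {P : Pred (Preferences n) 0ℓ} (P? : Decidable P) →
    (∀ a → P a → WIPF a × Prefers i i a) → (∀ a → WIPF a → Prefers i i a → P a) →
    count P? ≡ catalan (toℕ i) * catalan (n ∸ toℕ i)
  count-fixed i P? P⇒ ⇒P = begin
    count P?
      ≡⟨ card-≐ P? (staircaseThrough? 0 0 i i)
           (λ a p → WIPF⇒staircase a (proj₁ (P⇒ a p)) , proj₂ (P⇒ a p))
           (λ a (s , pref) → ⇒P a (staircase⇒WIPF a s) pref) ⟩
    card (staircaseThrough? 0 0 i i)
      ≡⟨ card-staircaseThrough n 0 0 0 i i refl ℕ.≤-refl refl ⟩
    ballot (toℕ i) 0 * ballot (n ∸ toℕ i) 0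
      ≡⟨ cong₂ _*_ (ballot≡catalan (toℕ i)) (ballot≡catalan (n ∸ toℕ i)) ⟩
    catalan (toℕ i) * catalan (n ∸ toℕ i) ∎

lemma4p1 : (n : ℕ) → 1 ≤ n →
    (∀ (i j : Fin n) → q n i j ≡ (if does (i ≟ j) then catalan (toℕ i) * catalan (n ∸ toℕ i) else 0))
    × (∀ (i : Fin n) → luckyCarCount n i ≡ catalan (toℕ i) * catalan (n ∸ toℕ i))
    × (∀ (i : Fin n) → luckySpotCount n i ≡ catalan (toℕ i) * catalan (n ∸ toℕ i))
lemma4p1 n _ = q-formula , luckyCar-formula , luckySpot-formula
  where
  q-formula : ∀ i j → q n i j ≡ (if does (i ≟ j) then catalan (toℕ i) * catalan (n ∸ toℕ i) else 0)
  q-formula i j with i ≟ j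
  ... | yes refl = count-fixed i _ (λ _ (w , pref , _) → w , pref)
                                   (λ a w pref → w , pref , prefers⇒lucky a w pref)
  -- A lucky car `i` parks in the spot `j` it prefers, but car `i` always parks in spot `i`.
  ... | no  i≢j  = card-none {n} {n} _ λ a (w , pref , lucky) → i≢j (trans (parksIn-unique a w lucky) pref)

  luckyCar-formula : ∀ i → luckyCarCount n i ≡ catalan (toℕ i) * catalan (n ∸ toℕ i)
  luckyCar-formula i = count-fixed i _ (λ a (w , lucky) → w , sym (parksIn-unique a w lucky))
                                       (λ a w pref → w , prefers⇒lucky a w pref)

  luckySpot-formula : ∀ i → luckySpotCount n i ≡ catalan (toℕ i) * catalan (n ∸ toℕ i)
  -- Car `j` itself witnesses that spot `j` is lucky; conversely, whichever car parks in spot `j` is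
  -- car `j`.
  luckySpot-formula j = count-fixed j _ to (λ a w pref → w , j , WIPF-parksIn a w j , pref)
    where
    to : ∀ a → WIPF a × LuckySpot j a → WIPF a × Prefers j j a
    to a (w , i , parks , pref) = w , subst (λ i → Prefers i j a) (parksIn-unique a w parks) pref
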